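{- Let $(V,d)$ be a metric space of doubling dimension $\kappa$ and diameter $W$, let $F\subseteq V$ be a finite set of facilities with costs $f_j>0$ for $j\in F$, and let $f_{\min}=\min_{j\in F}f_j$. Then there exist an abstract tree $\mathcal{T}$ whose nodes are indexed by pairs $\langle j,r\rangle$ with $j\in F$ and $r$ a non-negative integer, and, for each node $\langle j,r\rangle$, an associated area $A(j,r)\subseteq V$, with the following properties: (1) $\mathcal{T}$ has height $\mathcal{O}(\log(W/f_{\min}))$ and degree at most $2^{4\kappa}$, and for each node $\langle j,r\rangle$ of $\mathcal{T}$ with parent node $\langle j',r+1\rangle$, $B(j,7\cdot5^r)\subseteq B(j',7\cdot5^{r+1})$; (2) the family $\mathcal{A}$ of areas is laminar and its laminar structure is given by $\mathcal{T}$ (the area of each node contains the areas of its children, and the areas of two nodes neither of which is an ancestor of the other are disjoint), and every area satisfies $A(j,r)\subseteq B(j,7\cdot5^r)$; (3) for any subset $\mathcal{C}\subseteq V$ and any collection $\mathcal{B}$ of balls centered at facilities of $F$ whose union contains $\mathcal{C}$, there exists a collection $\mathcal{S}$ of nodes of $\mathcal{T}$ whose areas cover $\mathcal{C}$ and such that $$\sum_{\langle j,r\rangle\in\mathcal{S}}\bigl(f_j+7\cdot5^r\bigr)=\mathcal{O}(2^{2\kappa})\sum_{B(j,R)\in\mathcal{B}}(f_j+R).$$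
   Context: The doubling dimension of $(V,d)$ is $\kappa$ means every ball $B(x,\rho)$ can be covered by $2^\kappa$ balls of radius $\rho/2$, where $B(x,\rho)=\{y\in V:d(x,y)\le\rho\}$. A family of sets is laminar if any two of its members are either disjoint or one contains the other. The $\mathcal{O}(\cdot)$ notation hides absolute constants.
   Formalization: In (3) the node cost sum is multiplied by min(1, f_min): as stated, (3) fails for tiny f_min (one point, cost ε, ball of radius 0, while every node costs over 7). In (1) the height bound is O(log(max(W, f_min)/f_min)), since the logarithm is negative or undefined when W < f_min. -}

module Defs where

open import Algebra.Bundles using (CommutativeRing)
open import Algebra.Core using (Op₁)
open import Algebra.Definitions using (Congruent₁)
open import Data.Fin.Base using (Fin)
open import Data.List.Base using (List; []; _∷_; length; map; foldr)
open import Data.List.Relation.Unary.All using (All)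
open import Data.List.Relation.Unary.Any using (Any)
open import Data.List.Relation.Unary.Unique.Propositional using (Unique)
open import Data.Nat.Base using (ℕ; zero; suc)
open import Data.Product.Base using (_×_; _,_; ∃; ∃-syntax; proj₁; proj₂)
open import Data.Sum.Base using (_⊎_)
open import Function.Bundles using (_⇔_)
open import Function.Metric.Structures using (IsGeneralMetric)
open import Level using (Level; 0ℓ; _⊔_) renaming (suc to lsuc)
open import Relation.Binary.Bundles using (TotalOrder)
open import Relation.Binary.Core using (Rel)
open import Relation.Binary.Construct.Closure.ReflexiveTransitive using (Star; ε; _◅_)
open import Relation.Binary.PropositionalEquality using (_≡_)
open import Relation.Binary.Structures using (IsDecTotalOrder)
open import Relation.Nullary.Negation using (¬_)
open import Relation.Unary using (Pred; _∈_; _⊆_; _⊥_)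

import Algebra.Construct.NaturalChoice.Max as Max
import Algebra.Construct.NaturalChoice.Min as Min
import Algebra.Properties.Semiring.Exp as Exp
import Algebra.Properties.Semiring.Mult as Mult
import Relation.Binary.Construct.NonStrictToStrict as ToStrict

-- The real numbers, axiomatised as a complete ordered field.  A decidable
-- order together with suprema that are approximated from below by explicit
-- elements makes this the classical ℝ; the Archimedean property is a
-- consequence of `supremum`.  The value of `0# ⁻¹` is unspecified.

record RealField : Set₁ where
  field
    commutativeRing : CommutativeRing 0ℓ 0ℓ

  open CommutativeRing commutativeRing public
    renaming (Carrier to ℝ)

  infix 4 _≤_
  infix 8 _⁻¹
  field
    _≤_             : Rel ℝ 0ℓ
    isDecTotalOrder : IsDecTotalOrder _≈_ _≤_
    0≉1             : ¬ 0# ≈ 1#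
    +-monoˡ-≤       : ∀ z {x y} → x ≤ y → x + z ≤ y + z
    *-nonNegative   : ∀ {x y} → 0# ≤ x → 0# ≤ y → 0# ≤ x * y
    _⁻¹             : Op₁ ℝ
    ⁻¹-cong         : Congruent₁ _≈_ _⁻¹
    ⁻¹-inverseʳ     : ∀ {x} → ¬ x ≈ 0# → x * x ⁻¹ ≈ 1#

  open ToStrict _≈_ _≤_ public using (_<_)

  field
    supremum : (P : Pred ℝ 0ℓ) → ∃[ x ] x ∈ P → (∃[ b ] ∀ {x} → x ∈ P → x ≤ b) →
               ∃[ s ] (∀ {x} → x ∈ P → x ≤ s) ×
                      (∀ {y} → y < s → ∃[ x ] x ∈ P × y < x)

  private
    totalOrder : TotalOrder 0ℓ 0ℓ 0ℓ
    totalOrder = record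
      { isTotalOrder = IsDecTotalOrder.isTotalOrder isDecTotalOrder }

  open Max totalOrder public using () renaming (_⊔_ to max)
  open Min totalOrder public using () renaming (_⊓_ to min)
  open Exp semiring public using (_^_)

  ⟦_⟧ : ℕ → ℝ
  ⟦ n ⟧ = Mult._×_ semiring n 1#

  -- y = 2 ^ x, equivalently x = log₂ y, for real x: the rationals (a - b) / q
  -- below x are exactly those with 2 ^ ((a - b) / q) ≤ y.
  _Is2^_ : ℝ → ℝ → Set
  y Is2^ x = 0# < y ×
    (∀ (a b q : ℕ) →
      (⟦ a ⟧ ≤ ⟦ b ⟧ + ⟦ q ⟧ * x) ⇔ (⟦ 2 ⟧ ^ a ≤ ⟦ 2 ⟧ ^ b * y ^ q))

  IsMinimum : ∀ {n} → (Fin n → ℝ) → ℝ → Set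
  IsMinimum f m = (∃[ j ] f j ≈ m) × (∀ j → m ≤ f j)

  sumOver : ∀ {a} {A : Set a} → (A → ℝ) → List A → ℝ
  sumOver g xs = foldr _+_ 0# (map g xs)

record MetricSpace (𝓡 : RealField) (v ℓ : Level) : Set (lsuc (v ⊔ ℓ)) where
  private module R = RealField 𝓡
  open R using (ℝ; _≤_; _*_; _⁻¹; ⟦_⟧)
  infix 4 _≈ᵥ_
  field
    Point    : Set v
    _≈ᵥ_     : Rel Point ℓ
    d        : Point → Point → ℝ
    isMetric : IsGeneralMetric _≈ᵥ_ R._≈_ _≤_ R.0# R._+_ d

  Ball : Point → ℝ → Pred Point 0ℓ
  Ball x ρ y = d x y ≤ ρ

  -- D stands for 2 ^ κ, which need not be an integer: "covered by 2 ^ κ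
  -- balls" means covered by a number of balls not exceeding D.
  Doubling : ℝ → Set v
  Doubling D = ∀ x ρ → ∃[ centres ]
    ⟦ length centres ⟧ ≤ D ×
    (∀ {y} → y ∈ Ball x ρ → Any (λ c → y ∈ Ball c (ρ * ⟦ 2 ⟧ ⁻¹)) centres)

  IsDiameter : ℝ → Set v
  IsDiameter W = (∀ x y → d x y ≤ W) × (∀ u → (∀ x y → d x y ≤ u) → W ≤ u)

module _ {i a p : Level} {I : Set i} {X : Set a} where

  Laminar : Pred I 0ℓ → (I → Pred X p) → Set (i ⊔ a ⊔ p)
  Laminar N A = ∀ {x y} → x ∈ N → y ∈ N →
    (A x ⊥ A y) ⊎ (A x ⊆ A y) ⊎ (A y ⊆ A x)

-- A rooted tree whose nodes are some of the elements of I.  Uniqueness of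
-- parents and reachability of the parentless root exclude cycles.
record RootedTree (I : Set) : Set₁ where
  infix 4 _ChildOf_
  field
    Node          : Pred I 0ℓ
    _ChildOf_     : Rel I 0ℓ
    child-node    : ∀ {x y} → x ChildOf y → x ∈ Node
    parent-node   : ∀ {x y} → x ChildOf y → y ∈ Node
    parent-unique : ∀ {x y z} → x ChildOf y → x ChildOf z → y ≡ z
    root          : I
    root-node     : root ∈ Node
    root-orphan   : ∀ {y} → ¬ root ChildOf y
    to-root       : ∀ {x} → x ∈ Node → Star _ChildOf_ x root

  -- reflexive: every element counts as an ancestor of itself
  _AncestorOf_ : Rel I 0ℓ
  x AncestorOf y = Star _ChildOf_ y x

  edges : ∀ {x y} → Star _ChildOf_ x y → ℕ
  edges ε        = zero
  edges (_ ◅ xs) = suc (edges xs)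

module _ (𝓡 : RealField) {I : Set} (T : RootedTree I) where
  open RealField 𝓡
  open RootedTree T

  HeightAtMost : ℝ → Set
  HeightAtMost h = ∀ {x} (path : Star _ChildOf_ x root) → ⟦ edges path ⟧ ≤ h

  -- the degree of a node is its number of children
  DegreeAtMost : ℝ → Set
  DegreeAtMost k = ∀ {y} → y ∈ Node → ∀ xs → Unique xs → All (_ChildOf y) xs →
    ⟦ length xs ⟧ ≤ k

module Hierarchy {v ℓ} {𝓡 : RealField} (M : MetricSpace 𝓡 v ℓ)
  {n : ℕ} (loc : Fin n → MetricSpace.Point M) (f : Fin n → RealField.ℝ 𝓡)
  (T : RootedTree (Fin n × ℕ)) (A : Fin n × ℕ → Pred (MetricSpace.Point M) 0ℓ)
  where
  open RealField 𝓡
  open MetricSpace M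
  open RootedTree T

  radius : ℕ → ℝ
  radius r = ⟦ 7 ⟧ * ⟦ 5 ⟧ ^ r

  NodeBall : Fin n × ℕ → Pred Point 0ℓ
  NodeBall (j , r) = Ball (loc j) (radius r)

  NestedBalls : Set v
  NestedBalls = ∀ {x y} → x ChildOf y →
    proj₂ y ≡ suc (proj₂ x) × NodeBall x ⊆ NodeBall y

  -- Points form a setoid, so a subset is a predicate that respects _≈ᵥ_.
  AreasAreSubsets : Set (v ⊔ ℓ)
  AreasAreSubsets = ∀ {x} → x ∈ Node → ∀ {y z} → y ≈ᵥ z → y ∈ A x → z ∈ A x

  LaminarAlongTree : Set v
  LaminarAlongTree =
    (∀ {x y} → x ChildOf y → A x ⊆ A y) ×
    (∀ {x y} → x ∈ Node → y ∈ Node →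
      ¬ x AncestorOf y → ¬ y AncestorOf x → A x ⊥ A y)

  AreasInBalls : Set v
  AreasInBalls = ∀ {x} → x ∈ Node → A x ⊆ NodeBall x

  nodeCost : Fin n × ℕ → ℝ
  nodeCost (j , r) = f j + radius r

  ballCost : Fin n × ℝ → ℝ
  ballCost (j , R) = f j + R

  -- Node radii are at least 7 on an absolute scale, so in a one-point space with
  -- facility cost fmin the cost ratio is at least 7 / fmin: no constant δ can
  -- serve all fmin > 0.  The factor min 1# fmin is 1 once costs are normalised
  -- to fmin ≥ 1, and otherwise accounts for exactly this loss.
  CoversByNodes : (c : Level) (fmin δ : ℝ) → Set (v ⊔ lsuc c)
  CoversByNodes c fmin δ =
    (C : Pred Point c) (𝓑 : List (Fin n × ℝ)) → All (λ (_ , R) → 0# ≤ R) 𝓑 →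
    (∀ {y} → y ∈ C → Any (λ (j , R) → y ∈ Ball (loc j) R) 𝓑) →
    ∃[ S ] All Node S ×
      (∀ {y} → y ∈ C → Any (λ x → y ∈ A x) S) ×
      min 1# fmin * sumOver nodeCost S ≤ δ * sumOver ballCost 𝓑

{-# OPTIONS --safe #-}

-- Level r carries a greedy net of the facilities with 4 f ≤ 5 ^ r: its members
-- are more than 5 ^ r apart, and every such facility is within 5 ^ r of one.
-- Its parent at level r + 1 is a net member within 5 ^ (r + 1).  Going up
-- through the levels, a point joins the area of a net facility as soon as a
-- cheap enough facility lies within 5 ^ r / 2 of it, and from then on moves
-- with its area to the parents; so areas have radius at most 3/2 · 5 ^ r.
-- A ball B(j, R) is covered at a level r with 4 f_j ≤ 5 ^ r and 2 R ≤ 5 ^ r that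
-- cannot be lowered, so 5 ^ r = O(f_j + R): the areas meeting it belong to net
-- facilities within 2 · 5 ^ r of j, and there are at most 2 ^ 2κ of these.
-- At the top level t, 2 W ≤ 5 ^ t but not 2 W ≤ 5 ^ (t - 1); with 4 fmin ≤ 5 ^ r
-- at the level r of any node, this gives 2 ^ (t - r) ≤ W / fmin when r < t.

module Submission where

open import Defs
import Algebra.Construct.NaturalChoice.Max as Max
import Algebra.Construct.NaturalChoice.Min as Min
import Algebra.Properties.Ring as RingProperties
import Algebra.Properties.Semiring.Mult as Mult
import Algebra.Solver.Ring.NaturalCoefficients.Default as Solver
open import Data.Fin.Base as Fin using (Fin)
open import Data.Fin.Properties as Fin using (injective⇒≤)
open import Data.List.Base
  using (List; []; _∷_; _++_; length; map; filter; find; lookup; concatMap; allFin)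
open import Data.List.Membership.Propositional using ()
  renaming (_∈_ to _∈ˡ_; find to find∈; lose to lose∈)
open import Data.List.Membership.Propositional.Properties
  using (∈-lookup; ∈-filter⁺; ∈-allFin; ∈-map⁺)
open import Data.List.Properties using (length-++; length-map)
open import Data.List.Relation.Unary.All as All using (All; []; _∷_)
import Data.List.Relation.Unary.All.Properties as All
open import Data.List.Relation.Unary.AllPairs as AllPairs using (AllPairs; []; _∷_)
import Data.List.Relation.Unary.AllPairs.Properties as AllPairs
open import Data.List.Relation.Unary.Any as Any using (Any; here; there; any?)
import Data.List.Relation.Unary.Any.Properties as Any
open import Data.Maybe.Base as Maybe using (Maybe; just; nothing; _<∣>_)
open import Data.Maybe.Properties using (just-injective)
open import Data.Nat.Base as ℕ using (ℕ; zero; suc)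
import Data.Nat.Properties as ℕ
open import Data.Product.Base using (_×_; _,_; ∃-syntax; Σ-syntax; proj₁; proj₂)
open import Data.Sum.Base using (_⊎_; inj₁; inj₂)
open import Function.Base using (_∘_)
open import Function.Bundles using (mk⇔; Equivalence)
open import Function.Definitions using (Injective)
open import Function.Metric.Structures using (IsGeneralMetric)
open import Level using (Level; 0ℓ)
open import Relation.Binary.Bundles using (Poset; TotalOrder)
open import Relation.Binary.Construct.Closure.ReflexiveTransitive using (Star; ε; _◅_; _◅◅_)
open import Relation.Binary.Core using (Rel)
import Relation.Binary.Definitions as B
open import Relation.Binary.PropositionalEquality.Core as ≡ using (_≡_; _≢_)
import Relation.Binary.Reasoning.PartialOrder as PosetReasoning
open import Relation.Binary.Structures using (IsDecTotalOrder)
open import Relation.Nullary.Decidable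
  using (Dec; yes; no; does; True; toWitness; _×-dec_; does-⇔; decidable-stable)
open import Relation.Nullary.Negation using (¬_; contradiction)
open import Relation.Unary using (Pred; Decidable; _∈_; _⊆_; _⊥_)

-- Searching, pairwise relations and counting on lists

private variable
  a b p q : Level
  I X : Set a

-- Descends from `u` for as long as the predicate holds. The result need not be the least witness:
-- the level choices below only use that the predicate fails one step down.
crossing : {P : Pred ℕ p} → Decidable P → ∀ {u} → P u →
           ∃[ m ] P m × (∀ {k} → m ≡ suc k → ¬ P k)
crossing P? {zero}  pu = zero , pu , λ ()
crossing P? {suc u} pu with P? u
... | yes pu′ = crossing P? pu′
... | no ¬pu′ = suc u , pu , λ { ≡.refl → ¬pu′ }

find-just⇒P : {P : Pred X p} (P? : Decidable P) → ∀ xs {x} → find P? xs ≡ just x → P x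
find-just⇒P P? (x ∷ xs) eq with P? x
find-just⇒P P? (x ∷ xs) ≡.refl | yes px = px
... | no _ = find-just⇒P P? xs eq

Any⇒find-just : {P : Pred X p} (P? : Decidable P) → ∀ {xs} → Any P xs →
                ∃[ x ] find P? xs ≡ just x
Any⇒find-just P? {x ∷ xs} any-p with P? x | any-p
... | yes _ | _        = x , ≡.refl
... | no ¬p | here p   = contradiction p ¬p
... | no _  | there ps = Any⇒find-just P? ps

-- `find` looks only at the Boolean outcomes of the decisions. This makes ownership of a point
-- independent of its representative under `_≈ᵥ_`.
find-cong : {P : Pred X p} {Q : Pred X q} (P? : Decidable P) (Q? : Decidable Q) →
            (∀ x → does (P? x) ≡ does (Q? x)) → ∀ xs → find P? xs ≡ find Q? xs
find-cong P? Q? eq []       = ≡.refl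
find-cong P? Q? eq (x ∷ xs) rewrite eq x | find-cong P? Q? eq xs = ≡.refl

AllPairs-mapWithAll : {P : Pred X p} {R : Rel X a} {S : Rel X b} →
  (∀ {x y} → P x → P y → R x y → S x y) →
  ∀ {xs} → All P xs → AllPairs R xs → AllPairs S xs
AllPairs-mapWithAll f []         []         = []
AllPairs-mapWithAll f (px ∷ pxs) (rx ∷ rxs) =
  All.zipWith (λ (py , rxy) → f px py rxy) (pxs , rx) ∷ AllPairs-mapWithAll f pxs rxs

AllPairs-∈ : {R : Rel X a} → B.Symmetric R → ∀ {xs} → AllPairs R xs →
             ∀ {x y} → x ∈ˡ xs → y ∈ˡ xs → x ≡ y ⊎ R x y
AllPairs-∈ R-sym (rx ∷ rxs) (here ≡.refl) (here ≡.refl) = inj₁ ≡.refl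
AllPairs-∈ R-sym (rx ∷ rxs) (here ≡.refl) (there y∈xs)  = inj₂ (All.lookup rx y∈xs)
AllPairs-∈ R-sym (rx ∷ rxs) (there x∈xs)  (here ≡.refl) = inj₂ (R-sym (All.lookup rx x∈xs))
AllPairs-∈ R-sym (rx ∷ rxs) (there x∈xs)  (there y∈xs)  = AllPairs-∈ R-sym rxs x∈xs y∈xs

AllPairs-lookup : {R : Rel X a} → B.Symmetric R → ∀ {xs} → AllPairs R xs →
                  ∀ {i j} → i ≢ j → R (lookup xs i) (lookup xs j)
AllPairs-lookup R-sym (rx ∷ rxs) {Fin.zero}  {Fin.zero}  i≢j = contradiction ≡.refl i≢j
AllPairs-lookup R-sym (rx ∷ rxs) {Fin.zero}  {Fin.suc j} i≢j = All.lookup rx (∈-lookup j)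
AllPairs-lookup R-sym (rx ∷ rxs) {Fin.suc i} {Fin.zero}  i≢j = R-sym (All.lookup rx (∈-lookup i))
AllPairs-lookup R-sym (rx ∷ rxs) {Fin.suc i} {Fin.suc j} i≢j =
  AllPairs-lookup R-sym rxs (λ i≡j → i≢j (≡.cong Fin.suc i≡j))

-- Pigeonhole: each index is sent to the position of an element covering it, and since no element
-- serves two indices this map is injective.
length-≤-of-cover : {Q : I → X → Set q} {is : List I} {xs : List X} →
  AllPairs (λ i j → ∀ x → Q i x → ¬ Q j x) is →
  All (λ i → Any (Q i) xs) is → length is ℕ.≤ length xs
length-≤-of-cover {Q = Q} {is} {xs} exclusive covered = injective⇒≤ centre-injective
  where
  covering : ∀ i → Any (Q (lookup is i)) xs
  covering i = All.lookup covered (∈-lookup i)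
  centre : Fin (length is) → Fin (length xs)
  centre i = Any.index (covering i)
  centre-injective : ∀ {i j} → centre i ≡ centre j → i ≡ j
  centre-injective {i} {j} same = decidable-stable (i Fin.≟ j) λ i≢j →
    AllPairs-lookup (λ excl x qj qi → excl x qi qj) exclusive i≢j _
      (Any.lookup-index (covering i))
      (≡.subst (λ c → Q (lookup is j) (lookup xs c)) (≡.sym same) (Any.lookup-index (covering j)))

-- Greedy nets for a decidable relation

module GreedyNet {X : Set a} {_~_ : Rel X b} (_~?_ : B.Decidable _~_) where

  net : List X → List X
  net [] = []
  net (x ∷ xs) with any? (x ~?_) (net xs)
  ... | yes _ = net xs
  ... | no  _ = x ∷ net xs

  -- An element is dropped only when it is related to a kept one, and kept elements stay when the
  -- list grows at the front.
  net-covers : B.Reflexive _~_ → ∀ {xs x} → x ∈ˡ xs → Any (x ~_) (net xs)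
  net-covers ~-refl {x ∷ xs} x∈ with any? (x ~?_) (net xs) | x∈
  ... | yes x~ys | here ≡.refl = x~ys
  ... | no  _    | here ≡.refl = here ~-refl
  ... | yes _    | there x∈xs  = net-covers ~-refl x∈xs
  ... | no  _    | there x∈xs  = there (net-covers ~-refl x∈xs)

  net-separated : ∀ xs → AllPairs (λ x y → ¬ x ~ y) (net xs)
  net-separated []       = []
  net-separated (x ∷ xs) with any? (x ~?_) (net xs)
  ... | yes _ = net-separated xs
  ... | no ¬p = All.¬Any⇒All¬ (net xs) ¬p ∷ net-separated xs

  net-All : {P : Pred X p} → ∀ {xs} → All P xs → All P (net xs)
  net-All []                  = []
  net-All {xs = x ∷ xs} (px ∷ pxs) with any? (x ~?_) (net xs)
  ... | yes _ = net-All pxs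
  ... | no  _ = px ∷ net-All pxs

-- Arithmetic in the ordered field

module RealProperties (𝓡 : RealField) where
  open RealField 𝓡
  open IsDecTotalOrder isDecTotalOrder public
    using (total; _≤?_)
    renaming (refl to ≤-refl; trans to ≤-trans; reflexive to ≤-reflexive)
  open IsDecTotalOrder isDecTotalOrder using (antisym; isPartialOrder; isTotalOrder)
  open RingProperties ring using (-‿involutive; -‿distribˡ-*)
  open Solver commutativeSemiring public
    using (solve; _:=_; _:+_; _:*_; con; Polynomial)

  ≤-poset : Poset 0ℓ 0ℓ 0ℓ
  ≤-poset = record { isPartialOrder = isPartialOrder }

  open PosetReasoning ≤-poset

  -- The solver's own constants do not unfold to ⟦_⟧.
  num : ∀ {n} → ℕ → Polynomial n
  num zero    = con 0
  num (suc k) = con 1 :+ num k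

  private
    ≤-totalOrder : TotalOrder 0ℓ 0ℓ 0ℓ
    ≤-totalOrder = record { isTotalOrder = isTotalOrder }

    module ⊔ = Max ≤-totalOrder
    module ⊓ = Min ≤-totalOrder

  x≤max : ∀ x y → x ≤ max x y
  x≤max = ⊔.x≤x⊔y

  y≤max : ∀ x y → y ≤ max x y
  y≤max = ⊔.x≤y⊔x

  min≤x : ∀ x y → min x y ≤ x
  min≤x = ⊓.x⊓y≤x

  min≤y : ∀ x y → min x y ≤ y
  min≤y = ⊓.x⊓y≤y

  min-glb : ∀ {x y z} → x ≤ y → x ≤ z → x ≤ min y z
  min-glb = ⊓.⊓-glb

  ≰⇒≥ : ∀ {x y} → ¬ x ≤ y → y ≤ x
  ≰⇒≥ {x} {y} x≰y with total x y
  ... | inj₁ x≤y = contradiction x≤y x≰y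
  ... | inj₂ y≤x = y≤x

  +-mono-≤ : ∀ {x y u v} → x ≤ y → u ≤ v → x + u ≤ y + v
  +-mono-≤ {x} {y} {u} {v} x≤y u≤v = begin
    x + u ≤⟨ +-monoˡ-≤ u x≤y ⟩
    y + u ≈⟨ +-comm y u ⟩
    u + y ≤⟨ +-monoˡ-≤ y u≤v ⟩
    v + y ≈⟨ +-comm v y ⟩
    y + v ∎

  +-cancelʳ-≤ : ∀ z {x y} → x + z ≤ y + z → x ≤ y
  +-cancelʳ-≤ z {x} {y} x+z≤y+z = begin
    x             ≈⟨ lemma x ⟨
    x + z + - z   ≤⟨ +-monoˡ-≤ (- z) x+z≤y+z ⟩
    y + z + - z   ≈⟨ lemma y ⟩
    y             ∎
    where
    lemma : ∀ w → w + z + - z ≈ w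
    lemma w = trans (+-assoc w z (- z)) (trans (+-congˡ (-‿inverseʳ z)) (+-identityʳ w))

  x≤y+x : ∀ {x y} → 0# ≤ y → x ≤ y + x
  x≤y+x {x} {y} 0≤y = begin
    x       ≈⟨ +-identityˡ x ⟨
    0# + x  ≤⟨ +-monoˡ-≤ x 0≤y ⟩
    y + x   ∎

  x≤x+y : ∀ {x y} → 0# ≤ y → x ≤ x + y
  x≤x+y {x} {y} 0≤y = ≤-trans (x≤y+x 0≤y) (≤-reflexive (+-comm y x))

  -- Most distance bounds below are stated doubled, to keep fractions such as 5 ^ r / 2 out of the
  -- calculations; this undoes the doubling.
  x+x-cancel-≤ : ∀ {x y} → x + x ≤ y + y → x ≤ y
  x+x-cancel-≤ {x} {y} 2x≤2y with total x y
  ... | inj₁ x≤y = x≤y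
  ... | inj₂ y≤x = +-cancelʳ-≤ y (≤-trans (+-mono-≤ ≤-refl y≤x) 2x≤2y)

  *-monoʳ-≤ : ∀ {z x y} → 0# ≤ z → x ≤ y → z * x ≤ z * y
  *-monoʳ-≤ {z} {x} {y} 0≤z x≤y = begin
    z * x                ≤⟨ x≤y+x (*-nonNegative 0≤z 0≤y-x) ⟩
    z * (y - x) + z * x  ≈⟨ distribˡ z (y - x) x ⟨
    z * (y - x + x)      ≈⟨ *-congˡ (trans (+-assoc y (- x) x)
                              (trans (+-congˡ (-‿inverseˡ x)) (+-identityʳ y))) ⟩
    z * y                ∎
    where
    0≤y-x : 0# ≤ y - x
    0≤y-x = ≤-trans (≤-reflexive (sym (-‿inverseʳ x))) (+-monoˡ-≤ (- x) x≤y)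

  *-monoˡ-≤ : ∀ {z x y} → 0# ≤ z → x ≤ y → x * z ≤ y * z
  *-monoˡ-≤ {z} {x} {y} 0≤z x≤y = begin
    x * z ≈⟨ *-comm x z ⟩
    z * x ≤⟨ *-monoʳ-≤ 0≤z x≤y ⟩
    z * y ≈⟨ *-comm z y ⟩
    y * z ∎

  0≤1 : 0# ≤ 1#
  0≤1 with total 0# 1#
  ... | inj₁ 0≤1 = 0≤1
  ... | inj₂ 1≤0 = begin
    0#           ≤⟨ *-nonNegative 0≤-1 0≤-1 ⟩
    - 1# * - 1#  ≈⟨ -‿distribˡ-* 1# (- 1#) ⟨
    - (1# * - 1#) ≈⟨ -‿cong (*-identityˡ (- 1#)) ⟩
    - (- 1#)     ≈⟨ -‿involutive 1# ⟩
    1#           ∎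
    where
    0≤-1 : 0# ≤ - 1#
    0≤-1 = begin
      0#         ≈⟨ -‿inverseʳ 1# ⟨
      1# + - 1#  ≤⟨ +-monoˡ-≤ (- 1#) 1≤0 ⟩
      0# + - 1#  ≈⟨ +-identityˡ (- 1#) ⟩
      - 1#       ∎

  ⟦⟧-* : ∀ m n → ⟦ m ℕ.* n ⟧ ≈ ⟦ m ⟧ * ⟦ n ⟧
  ⟦⟧-* = Mult.×1-homo-* semiring

  0≤⟦_⟧ : ∀ n → 0# ≤ ⟦ n ⟧
  0≤⟦ zero  ⟧ = ≤-refl
  0≤⟦ suc n ⟧ = ≤-trans 0≤1 (x≤x+y 0≤⟦ n ⟧)

  ⟦⟧-mono : ∀ {m n} → m ℕ.≤ n → ⟦ m ⟧ ≤ ⟦ n ⟧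
  ⟦⟧-mono {n = n} ℕ.z≤n = 0≤⟦ n ⟧
  ⟦⟧-mono (ℕ.s≤s m≤n)   = +-mono-≤ ≤-refl (⟦⟧-mono m≤n)

  -- For closed numerals the implicit argument is solved by evaluating the comparison.
  ⟦⟧*-monoˡ : ∀ m n {m≤n : True (m ℕ.≤? n)} {x} → 0# ≤ x → ⟦ m ⟧ * x ≤ ⟦ n ⟧ * x
  ⟦⟧*-monoˡ m n {m≤n} 0≤x = *-monoˡ-≤ 0≤x (⟦⟧-mono (toWitness m≤n))

  0<1+n : ∀ n → ¬ ⟦ suc n ⟧ ≈ 0#
  0<1+n n 1+n≈0 = 0≉1 (antisym 0≤1 (≤-trans (x≤x+y 0≤⟦ n ⟧) (≤-reflexive 1+n≈0)))

  half : ℝ → ℝ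
  half x = x * ⟦ 2 ⟧ ⁻¹

  half-double : ∀ x → half (x + x) ≈ x
  half-double x = begin-equality
    (x + x) * ⟦ 2 ⟧ ⁻¹    ≈⟨ *-congʳ (solve 1 (λ x → x :+ x := x :* num 2) refl x) ⟩
    x * ⟦ 2 ⟧ * ⟦ 2 ⟧ ⁻¹  ≈⟨ *-assoc x ⟦ 2 ⟧ (⟦ 2 ⟧ ⁻¹) ⟩
    x * (⟦ 2 ⟧ * ⟦ 2 ⟧ ⁻¹) ≈⟨ *-congˡ (⁻¹-inverseʳ (0<1+n 1)) ⟩
    x * 1#                ≈⟨ *-identityʳ x ⟩
    x                     ∎

  half+half : ∀ x → half x + half x ≈ x
  half+half x = trans (sym (distribʳ (⟦ 2 ⟧ ⁻¹) x x)) (half-double x)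

  ⁻¹-nonNegative : ∀ {x} → 0# < x → 0# ≤ x ⁻¹
  ⁻¹-nonNegative {x} (0≤x , 0≉x) with total 0# (x ⁻¹)
  ... | inj₁ 0≤x⁻¹ = 0≤x⁻¹
  ... | inj₂ x⁻¹≤0 = contradiction (antisym 0≤1 1≤0) 0≉1
    where
    1≤0 : 1# ≤ 0#
    1≤0 = begin
      1#       ≈⟨ ⁻¹-inverseʳ (λ x≈0 → 0≉x (sym x≈0)) ⟨
      x * x ⁻¹ ≤⟨ *-monoʳ-≤ 0≤x x⁻¹≤0 ⟩
      x * 0#   ≈⟨ zeroʳ x ⟩
      0#       ∎

  ^-nonNegative : ∀ {x} n → 0# ≤ x → 0# ≤ x ^ n
  ^-nonNegative zero    0≤x = 0≤1
  ^-nonNegative (suc n) 0≤x = *-nonNegative 0≤x (^-nonNegative n 0≤x)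

  sumOver-++ : ∀ {a} {A : Set a} (g : A → ℝ) xs ys →
               sumOver g (xs ++ ys) ≈ sumOver g xs + sumOver g ys
  sumOver-++ g []       ys = sym (+-identityˡ _)
  sumOver-++ g (x ∷ xs) ys = trans (+-congˡ (sumOver-++ g xs ys)) (sym (+-assoc _ _ _))

  sumOver≤length* : ∀ {a} {A : Set a} {g : A → ℝ} {u} {xs} →
                    All (λ x → g x ≤ u) xs → sumOver g xs ≤ ⟦ length xs ⟧ * u
  sumOver≤length* {u = u} [] = ≤-reflexive (sym (zeroˡ u))
  sumOver≤length* {g = g} {u} {x ∷ xs} (gx≤u ∷ gxs≤u) = begin
    g x + sumOver g xs        ≤⟨ +-mono-≤ gx≤u (sumOver≤length* gxs≤u) ⟩
    u + ⟦ length xs ⟧ * u      ≈⟨ solve 2 (λ u l → u :+ l :* u := (con 1 :+ l) :* u) refl u ⟦ length xs ⟧ ⟩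
    (1# + ⟦ length xs ⟧) * u   ∎

  -- Powers of five and the Archimedean property

  5^_ : ℕ → ℝ
  5^ r = ⟦ 5 ⟧ ^ r

  0≤5^ : ∀ r → 0# ≤ 5^ r
  0≤5^ r = ^-nonNegative r 0≤⟦ 5 ⟧

  5^-step : ∀ r → 5^ r ≤ 5^ (suc r)
  5^-step r = begin
    5^ r         ≈⟨ solve 1 (λ x → x := num 1 :* x) refl (5^ r) ⟩
    ⟦ 1 ⟧ * 5^ r ≤⟨ ⟦⟧*-monoˡ 1 5 (0≤5^ r) ⟩
    ⟦ 5 ⟧ * 5^ r ∎

  5^-mono : ∀ {r s} → r ℕ.≤′ s → 5^ r ≤ 5^ s
  5^-mono (ℕ.≤′-reflexive ≡.refl) = ≤-refl
  5^-mono (ℕ.≤′-step {n} r≤s)     = ≤-trans (5^-mono r≤s) (5^-step n)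

  1≤5^ : ∀ r → 1# ≤ 5^ r
  1≤5^ r = 5^-mono (ℕ.≤⇒≤′ {y = r} ℕ.z≤n)

  -- The supremum s of the reals that are at most x and at most some 5^ r is
  -- approximated by a z > s - 1; as s < 5^ (suc r), that power exceeds x.
  5^-unbounded : ∀ x → ∃[ r ] x ≤ 5^ r
  5^-unbounded x with x ≤? 1#
  ... | yes x≤1 = 0 , x≤1
  ... | no  x≰1 with supremum (λ z → z ≤ x × ∃[ r ] z ≤ 5^ r)
                       (1# , ≰⇒≥ x≰1 , 0 , ≤-refl) (x , proj₁)
  ... | s , upper , approx with approx {s - 1#} s-1<s
    where
    s-1+1≈s : s - 1# + 1# ≈ s
    s-1+1≈s = trans (+-assoc s (- 1#) 1#) (trans (+-congˡ (-‿inverseˡ 1#)) (+-identityʳ s))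
    s-1<s : s - 1# < s
    s-1<s = ≤-trans (x≤x+y 0≤1) (≤-reflexive s-1+1≈s) , λ s-1≈s →
      0≉1 (antisym 0≤1 (+-cancelʳ-≤ s (≤-reflexive
        (trans (+-comm 1# s) (trans (+-congʳ (sym s-1≈s)) (trans s-1+1≈s (sym (+-identityˡ s))))))))
  ... | z , (z≤x , r , z≤5^r) , s-1<z with x ≤? 5^ (suc r)
  ... | yes x≤5^r+1 = suc r , x≤5^r+1
  ... | no  x≰5^r+1 = contradiction (antisym (proj₁ s-1<z) z≤s-1) (proj₂ s-1<z)
    where
    z≤s-1 : z ≤ s - 1#
    z≤s-1 = begin
      z                   ≈⟨ solve 1 (λ z → z := z :+ con 0) refl z ⟩
      z + 0#              ≈⟨ +-congˡ (-‿inverseʳ 1#) ⟨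
      z + (1# - 1#)       ≈⟨ +-assoc z 1# (- 1#) ⟨
      z + 1# - 1#         ≤⟨ +-monoˡ-≤ (- 1#) z+1≤s ⟩
      s - 1#              ∎
      where
      z+1≤s : z + 1# ≤ s
      z+1≤s = begin
        z + 1#                   ≤⟨ +-mono-≤ z≤5^r (1≤5^ r) ⟩
        5^ r + 5^ r              ≈⟨ solve 1 (λ x → x :+ x := num 2 :* x) refl (5^ r) ⟩
        ⟦ 2 ⟧ * 5^ r             ≤⟨ ⟦⟧*-monoˡ 2 5 (0≤5^ r) ⟩
        ⟦ 5 ⟧ * 5^ r             ≤⟨ upper (≰⇒≥ x≰5^r+1 , suc r , ≤-refl) ⟩
        s                        ∎

-- Covering and packing in a doubling metric

module Packing {v ℓ} {𝓡 : RealField} (M : MetricSpace 𝓡 v ℓ) where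
  open RealField 𝓡
  open RealProperties 𝓡
  open MetricSpace M
  open PosetReasoning ≤-poset

  d-sym : ∀ x y → d x y ≈ d y x
  d-sym = IsGeneralMetric.sym isMetric

  d-flip : ∀ {x y u} → d x y ≤ u → d y x ≤ u
  d-flip = ≤-trans (≤-reflexive (d-sym _ _))

  triangle : ∀ x y z → d x z ≤ d x y + d y z
  triangle = IsGeneralMetric.triangle isMetric

  triangle-≤ : ∀ {x y z u w} → d x y ≤ u → d y z ≤ w → d x z ≤ u + w
  triangle-≤ dxy≤u dyz≤w = ≤-trans (triangle _ _ _) (+-mono-≤ dxy≤u dyz≤w)

  d-refl≤ : ∀ x {ρ} → 0# ≤ ρ → d x x ≤ ρ
  d-refl≤ x 0≤ρ = ≤-trans (≤-reflexive (IsGeneralMetric.≈⇒0 isMetric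
    (IsGeneralMetric.EqC.refl isMetric))) 0≤ρ

  -- The radius 2 ^ k ρ, written as iterated sums so that one use of the doubling property removes
  -- one layer through `half-double`.
  double^ : ℕ → ℝ → ℝ
  double^ zero    ρ = ρ
  double^ (suc k) ρ = double^ k ρ + double^ k ρ

  module _ {D : ℝ} (doubling : Doubling D) where

    -- A ball of radius zero contains its centre, so its cover has at least one member.
    1≤D : Point → 1# ≤ D
    1≤D x with doubling x 0#
    ... | centres , few , covers = begin
      1#                  ≈⟨ +-identityʳ 1# ⟨
      ⟦ 1 ⟧               ≤⟨ ⟦⟧-mono (nonempty (covers (d-refl≤ x ≤-refl))) ⟩
      ⟦ length centres ⟧  ≤⟨ few ⟩
      D                   ∎
      where
      nonempty : ∀ {P : Pred Point 0ℓ} {cs} → Any P cs → 1 ℕ.≤ length cs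
      nonempty (here _)  = ℕ.s≤s ℕ.z≤n
      nonempty (there _) = ℕ.s≤s ℕ.z≤n

    0≤D : Point → 0# ≤ D
    0≤D x = ≤-trans 0≤1 (1≤D x)

    Cover : ℕ → ℝ → Point → Set _
    Cover k ρ x = ∃[ centres ] ⟦ length centres ⟧ ≤ D ^ k ×
      (∀ {y} → y ∈ Ball x (double^ k ρ) → Any (λ c → y ∈ Ball c ρ) centres)

    -- Each of the at most `D` balls of half the radius is covered recursively by at most `D ^ k`
    -- balls, and the resulting lists are concatenated.
    cover : ∀ k ρ x → Cover k ρ x
    cover zero    ρ x = x ∷ [] , ≤-reflexive (+-identityʳ 1#) , here
    cover (suc k) ρ x with doubling x (double^ (suc k) ρ)
    ... | centres , few , covers =
      concatMap (λ c → proj₁ (cover k ρ c)) centres ,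
      ≤-trans (length-concat centres) (*-monoˡ-≤ (^-nonNegative k (0≤D x)) few) ,
      λ y∈ → Any.concatMap⁺ (λ c → proj₁ (cover k ρ c)) (Any.map (λ {c} y∈c →
        proj₂ (proj₂ (cover k ρ c)) (≤-trans y∈c (≤-reflexive (half-double _)))) (covers y∈))
      where
      length-concat : ∀ cs → ⟦ length (concatMap (λ c → proj₁ (cover k ρ c)) cs) ⟧ ≤
                             ⟦ length cs ⟧ * D ^ k
      length-concat []       = ≤-reflexive (sym (zeroˡ (D ^ k)))
      length-concat (c ∷ cs) = begin
        ⟦ length (cs₁ ++ cs₂) ⟧              ≡⟨ ≡.cong ⟦_⟧ (length-++ cs₁) ⟩
        ⟦ length cs₁ ℕ.+ length cs₂ ⟧        ≈⟨ Mult.×-homo-+ semiring 1# (length cs₁) (length cs₂) ⟩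
        ⟦ length cs₁ ⟧ + ⟦ length cs₂ ⟧      ≤⟨ +-mono-≤ (proj₁ (proj₂ (cover k ρ c))) (length-concat cs) ⟩
        D ^ k + ⟦ length cs ⟧ * D ^ k        ≈⟨ solve 2 (λ u l → u :+ l :* u := (con 1 :+ l) :* u) refl (D ^ k) ⟦ length cs ⟧ ⟩
        ⟦ length (c ∷ cs) ⟧ * D ^ k          ∎
        where
        cs₁ = proj₁ (cover k ρ c)
        cs₂ = concatMap (λ c → proj₁ (cover k ρ c)) cs

    -- Two points in one ball of radius `ρ` are at most 2 ρ apart, so every covering ball holds at
    -- most one of the separated points.
    packing : ∀ k ρ x {I : Set} (loc : I → Point) {is} →
      AllPairs (λ i j → ¬ d (loc i) (loc j) ≤ ρ + ρ) is →
      All (λ i → loc i ∈ Ball x (double^ k ρ)) is → ⟦ length is ⟧ ≤ D ^ k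
    packing k ρ x loc separated inside with cover k ρ x
    ... | centres , few , covers = ≤-trans (⟦⟧-mono (length-≤-of-cover
      (AllPairs.map (λ far c i∈ j∈ → far (triangle-≤ (d-flip i∈) j∈)) separated)
      (All.map covers inside))) few

-- Nets of cheap facilities at each level

module Nets {v ℓ} {𝓡 : RealField} (M : MetricSpace 𝓡 v ℓ)
  {n : ℕ} (loc : Fin n → MetricSpace.Point M) (f : Fin n → RealField.ℝ 𝓡)
  where
  open RealField 𝓡 hiding (zero)
  open RealProperties 𝓡
  open MetricSpace M
  open Packing M
  open PosetReasoning ≤-poset

  Near : ℕ → Fin n → Fin n → Set
  Near r i j = d (loc i) (loc j) ≤ 5^ r

  near? : ∀ r i j → Dec (Near r i j)
  near? r i j = d (loc i) (loc j) ≤? 5^ r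

  -- Only cheap facilities live at level r, so that a node costs O(5 ^ r).
  Eligible : ℕ → Fin n → Set
  Eligible r i = ⟦ 4 ⟧ * f i ≤ 5^ r

  eligible? : ∀ r i → Dec (Eligible r i)
  eligible? r i = ⟦ 4 ⟧ * f i ≤? 5^ r

  eligible-suc : ∀ r {i} → Eligible r i → Eligible (suc r) i
  eligible-suc r elig = ≤-trans elig (5^-step r)

  module Greedy r = GreedyNet (near? r)

  net : ℕ → List (Fin n)
  net r = Greedy.net r (filter (eligible? r) (allFin n))

  net-eligible : ∀ r → All (Eligible r) (net r)
  net-eligible r = Greedy.net-All r (All.all-filter (eligible? r) (allFin n))

  net-separated : ∀ r → AllPairs (λ i j → ¬ Near r i j) (net r)
  net-separated r = Greedy.net-separated r (filter (eligible? r) (allFin n))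

  net-unique : ∀ r {i j} → i ∈ˡ net r → j ∈ˡ net r → Near r i j → i ≡ j
  net-unique r i∈ j∈ near with AllPairs-∈ (λ far → far ∘ d-flip) (net-separated r) i∈ j∈
  ... | inj₁ i≡j = i≡j
  ... | inj₂ far = contradiction near far

  parent : ℕ → Fin n → Fin n
  parent r i with any? (near? r i) (net r)
  ... | yes near-some = proj₁ (find∈ near-some)
  -- A default value, never reached for an eligible `i`, as `parent-spec` shows.
  ... | no  _         = i

  parent-spec : ∀ r {i} → Eligible r i → parent r i ∈ˡ net r × Near r i (parent r i)
  parent-spec r {i} elig with any? (near? r i) (net r)
  ... | yes near-some = proj₂ (find∈ near-some)
  ... | no  ¬near     = contradiction
    (Greedy.net-covers r (λ {x} → d-refl≤ (loc x) (0≤5^ r)) (∈-filter⁺ (eligible? r) (∈-allFin i) elig)) ¬near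

  -- Assigning points to net facilities

  Touches : ℕ → Point → Fin n → Set
  Touches r y i = Eligible r i × d (loc i) y + d (loc i) y ≤ 5^ r

  touches? : ∀ r y i → Dec (Touches r y i)
  touches? r y i = eligible? r i ×-dec (d (loc i) y + d (loc i) y ≤? 5^ r)

  direct : ℕ → Point → Maybe (Fin n)
  direct r y = Maybe.map (parent r) (find (touches? r y) (allFin n))

  -- The net facility whose level-r area contains y: inherited from the level
  -- below if y is already in an area there.
  owner : ℕ → Point → Maybe (Fin n)
  owner zero    y = direct zero y
  owner (suc r) y = Maybe.map (parent (suc r)) (owner r y) <∣> direct (suc r) y

  direct-cong : ∀ r {y z} → y ≈ᵥ z → direct r y ≡ direct r z
  direct-cong r {y} {z} y≈z = ≡.cong (Maybe.map (parent r)) (find-cong (touches? r y) (touches? r z)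
    (λ i → does-⇔ (mk⇔ (touches-resp y≈z) (touches-resp (IsGeneralMetric.EqC.sym isMetric y≈z)))
                  (touches? r y i) (touches? r z i)) (allFin n))
    where
    touches-resp : ∀ {y z i} → y ≈ᵥ z → Touches r y i → Touches r z i
    touches-resp y≈z (elig , close) =
      elig , ≤-trans (≤-reflexive (+-cong (eq y≈z) (eq y≈z))) close
      where
      eq : ∀ {y z x} → y ≈ᵥ z → d x z ≈ d x y
      eq y≈z = IsGeneralMetric.cong isMetric (IsGeneralMetric.EqC.refl isMetric)
                 (IsGeneralMetric.EqC.sym isMetric y≈z)

  owner-cong : ∀ r {y z} → y ≈ᵥ z → owner r y ≡ owner r z
  owner-cong zero    y≈z = direct-cong zero y≈z
  owner-cong (suc r) y≈z = ≡.cong₂ (λ o → Maybe.map (parent (suc r)) o <∣>_)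
    (owner-cong r y≈z) (direct-cong (suc r) y≈z)

  -- The invariant of ownership: the owner is at distance at most 3/2 times 5 ^ r, in doubled form.
  OwnedBy : ℕ → Point → Fin n → Set
  OwnedBy r y j = j ∈ˡ net r × d (loc j) y + d (loc j) y ≤ ⟦ 3 ⟧ * 5^ r

  -- Moving to a net member adds at most 5 ^ r to the distance, so 2 times 5 ^ r to its double. The
  -- bound `u` is left free to serve both freshly touched points and points inherited from the level
  -- below.
  move-to-parent : ∀ r {i y u} → Eligible r i → d (loc i) y + d (loc i) y ≤ u →
    ⟦ 2 ⟧ * 5^ r + u ≤ ⟦ 3 ⟧ * 5^ r → OwnedBy r y (parent r i)
  move-to-parent r {i} {y} {u} elig close u≤ with parent-spec r elig
  ... | j∈ , near = j∈ , (begin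
    d (loc j) y + d (loc j) y        ≤⟨ +-mono-≤ tri tri ⟩
    (5^ r + δ) + (5^ r + δ)          ≈⟨ solve 2 (λ p δ → (p :+ δ) :+ (p :+ δ) := num 2 :* p :+ (δ :+ δ)) refl (5^ r) δ ⟩
    ⟦ 2 ⟧ * 5^ r + (δ + δ)           ≤⟨ +-mono-≤ ≤-refl close ⟩
    ⟦ 2 ⟧ * 5^ r + u                 ≤⟨ u≤ ⟩
    ⟦ 3 ⟧ * 5^ r                     ∎)
    where
    j = parent r i
    δ = d (loc i) y
    tri : d (loc j) y ≤ 5^ r + δ
    tri = triangle-≤ (d-flip near) ≤-refl

  direct-OwnedBy : ∀ r {y j} → direct r y ≡ just j → OwnedBy r y j
  direct-OwnedBy r {y} eq with find (touches? r y) (allFin n) in found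
  direct-OwnedBy r {y} ≡.refl | just i with find-just⇒P (touches? r y) (allFin n) found
  ... | elig , close = move-to-parent r elig close (≤-reflexive
    (solve 1 (λ p → num 2 :* p :+ p := num 3 :* p) refl (5^ r)))

  owner-OwnedBy : ∀ r {y j} → owner r y ≡ just j → OwnedBy r y j
  owner-OwnedBy zero    eq = direct-OwnedBy zero eq
  owner-OwnedBy (suc r) {y} eq with owner r y in owned
  ... | nothing = direct-OwnedBy (suc r) eq
  owner-OwnedBy (suc r) {y} ≡.refl | just i with owner-OwnedBy r owned
  -- Here growth by a factor of five keeps the invariant: in units of the lower power, 2 times 5
  -- plus 3 is 13, below 3 times 5.
  ... | i∈ , close = move-to-parent (suc r) (eligible-suc r (All.lookup (net-eligible r) i∈)) close (begin
    ⟦ 2 ⟧ * (⟦ 5 ⟧ * 5^ r) + ⟦ 3 ⟧ * 5^ r ≈⟨ solve 1 (λ p → num 2 :* (num 5 :* p) :+ num 3 :* p := num 13 :* p) refl (5^ r) ⟩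
    ⟦ 13 ⟧ * 5^ r                        ≤⟨ ⟦⟧*-monoˡ 13 15 (0≤5^ r) ⟩
    ⟦ 15 ⟧ * 5^ r                        ≈⟨ solve 1 (λ p → num 15 :* p := num 3 :* (num 5 :* p)) refl (5^ r) ⟩
    ⟦ 3 ⟧ * (⟦ 5 ⟧ * 5^ r)               ∎)

  touched⇒direct : ∀ r {y i} → Touches r y i → ∃[ j ] direct r y ≡ just j
  touched⇒direct r {y} {i} touches with Any⇒find-just (touches? r y) (lose∈ (∈-allFin i) touches)
  ... | i′ , found = parent r i′ , ≡.cong (Maybe.map (parent r)) found

  touched⇒owned : ∀ r {y i} → Touches r y i → ∃[ j ] owner r y ≡ just j
  touched⇒owned zero touches = touched⇒direct zero touches
  touched⇒owned (suc r) {y} touches with owner r y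
  ... | just i  = parent (suc r) i , ≡.refl
  ... | nothing = touched⇒direct (suc r) touches

  -- Inheritance takes precedence over a direct assignment, so points that share an owner share it
  -- at all higher levels. Laminarity rests on this.
  owner-suc : ∀ r {y j} → owner r y ≡ just j → owner (suc r) y ≡ just (parent (suc r) j)
  owner-suc r owned rewrite owned = ≡.refl

  -- The tree of net facilities up to the top level

  module Tree (f>0 : ∀ j → 0# < f j) {fmin : ℝ} (fmin-min : IsMinimum f fmin)
    (t : ℕ) (4fmin≤5^t : ⟦ 4 ⟧ * fmin ≤ 5^ t) (diameter≤ : ∀ x y → d x y + d x y ≤ 5^ t)
    where

    cheapest : Fin n
    cheapest = proj₁ (proj₁ fmin-min)

    f[cheapest]≈fmin : f cheapest ≈ fmin
    f[cheapest]≈fmin = proj₂ (proj₁ fmin-min)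

    0<fmin : 0# < fmin
    0<fmin = ≤-trans (proj₁ (f>0 cheapest)) (≤-reflexive f[cheapest]≈fmin) ,
      λ 0≈fmin → proj₂ (f>0 cheapest) (trans 0≈fmin (sym f[cheapest]≈fmin))

    cheapest-eligible : Eligible t cheapest
    cheapest-eligible = ≤-trans (≤-reflexive (*-congˡ f[cheapest]≈fmin)) 4fmin≤5^t

    -- Areas of one level are the fibres of `owner r`, hence disjoint by construction.
    area : Fin n × ℕ → Pred Point 0ℓ
    area (j , r) y = owner r y ≡ just j

    up : Fin n × ℕ → Fin n × ℕ
    up (j , r) = parent (suc r) j , suc r

    IsNode : Pred (Fin n × ℕ) 0ℓ
    IsNode (j , r) = j ∈ˡ net r × r ℕ.≤ t

    -- The parent is a function of the child, which makes it unique; the strict bound on the level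
    -- leaves the root without a parent.
    _⊲_ : Fin n × ℕ → Fin n × ℕ → Set
    x ⊲ y = x ∈ IsNode × proj₂ x ℕ.< t × y ≡ up x

    up-near : ∀ {j r} → (j , r) ∈ IsNode → parent (suc r) j ∈ˡ net (suc r) × Near (suc r) j (parent (suc r) j)
    up-near {j} {r} (j∈ , _) = parent-spec (suc r) (eligible-suc r (All.lookup (net-eligible r) j∈))

    up-node : ∀ {x y} → x ⊲ y → y ∈ IsNode
    up-node (x∈ , r<t , ≡.refl) = proj₁ (up-near x∈) , r<t

    root : Fin n × ℕ
    root = parent t cheapest , t

    root-node : root ∈ IsNode
    root-node = proj₁ (parent-spec t cheapest-eligible) , ℕ.≤-refl

    d≤5^t : ∀ x y → d x y ≤ 5^ t
    d≤5^t x y = ≤-trans (x≤x+y (IsGeneralMetric.nonNegative isMetric)) (diameter≤ x y)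

    -- All distances are at most 5 ^ t, while distinct members of the top net are farther apart than
    -- that, so this net has a single member.
    top-is-root : ∀ {x} → x ∈ IsNode → proj₂ x ≡ t → x ≡ root
    top-is-root (j∈ , _) ≡.refl =
      ≡.cong (_, t) (net-unique t j∈ (proj₁ root-node) (d≤5^t _ _))

    path-node : ∀ {x y} → x ∈ IsNode → Star _⊲_ x y → y ∈ IsNode
    path-node x∈ ε           = x∈
    path-node x∈ (x⊲z ◅ zs) = path-node (up-node x⊲z) zs

    -- The step of `≤′` sits at its upper end, so the recursion appends one `up` edge at the top of
    -- the path.
    climb : ∀ {x s} → x ∈ IsNode → proj₂ x ℕ.≤′ s → s ℕ.≤ t →
            ∃[ z ] Star _⊲_ x z × proj₂ z ≡ s
    climb {x} x∈ (ℕ.≤′-reflexive ≡.refl) _ = x , ε , ≡.refl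
    climb x∈ (ℕ.≤′-step r≤s) s<t with climb x∈ r≤s (ℕ.<⇒≤ s<t)
    ... | z , path , ≡.refl =
      up z , path ◅◅ (path-node x∈ path , s<t , ≡.refl) ◅ ε , ≡.refl

    climb-to-root : ∀ {x} → x ∈ IsNode → Star _⊲_ x root
    climb-to-root {x} x∈@(_ , r≤t) with climb x∈ (ℕ.≤⇒≤′ r≤t) ℕ.≤-refl
    ... | z , path , level≡t = ≡.subst (Star _⊲_ x) (top-is-root (path-node x∈ path) level≡t) path

    T : RootedTree (Fin n × ℕ)
    T = record
      { Node          = IsNode
      ; _ChildOf_     = _⊲_
      ; child-node    = proj₁
      ; parent-node   = up-node
      ; parent-unique = λ { (_ , _ , ≡.refl) (_ , _ , ≡.refl) → ≡.refl }
      ; root          = root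
      ; root-node     = root-node
      ; root-orphan   = λ (_ , t<t , _) → ℕ.<-irrefl ≡.refl t<t
      ; to-root       = climb-to-root
      }

    -- Laminarity of the areas and containment in balls

    open RootedTree T using (edges; _AncestorOf_)
    open Hierarchy M loc f T area

    edges+level : ∀ {x y} (path : Star _⊲_ x y) → edges path ℕ.+ proj₂ x ≡ proj₂ y
    edges+level ε = ≡.refl
    edges+level {x} ((_ , _ , ≡.refl) ◅ path) =
      ≡.trans (≡.sym (ℕ.+-suc (edges path) (proj₂ x))) (edges+level path)

    area-up : ∀ {x y} → x ⊲ y → area x ⊆ area y
    area-up {_ , r} (_ , _ , ≡.refl) = owner-suc r

    area-path : ∀ {x y} → Star _⊲_ x y → area x ⊆ area y
    area-path ε            = λ y∈ → y∈
    area-path (x⊲z ◅ path) = λ y∈ → area-path path (area-up x⊲z y∈)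

    area-level-unique : ∀ {x y p} → proj₂ x ≡ proj₂ y → p ∈ area x → p ∈ area y → x ≡ y
    area-level-unique ≡.refl p∈x p∈y = ≡.cong (_, _) (just-injective (≡.trans (≡.sym p∈x) p∈y))

    -- The ancestor of `x` at the level of `y` contains the area of `x`. Either it is `y`, or it is
    -- another node of that level, whose area is disjoint from that of `y`.
    ancestor-or-disjoint : ∀ {x y} → x ∈ IsNode → y ∈ IsNode → proj₂ x ℕ.≤ proj₂ y →
                           y AncestorOf x ⊎ area x ⊥ area y
    ancestor-or-disjoint {x} {y} x∈ (_ , s≤t) r≤s with climb x∈ (ℕ.≤⇒≤′ r≤s) s≤t
    ... | z , path , ≡.refl with proj₁ z Fin.≟ proj₁ y
    ...   | yes ≡.refl = inj₁ path
    ...   | no  z≢y    = inj₂ λ (p∈x , p∈y) →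
      z≢y (≡.cong proj₁ (area-level-unique {z} {y} ≡.refl (area-path path p∈x) p∈y))

    trichotomy : ∀ {x y} → x ∈ IsNode → y ∈ IsNode →
                 area x ⊥ area y ⊎ y AncestorOf x ⊎ x AncestorOf y
    trichotomy {x} {y} x∈ y∈ with ℕ.≤-total (proj₂ x) (proj₂ y)
    ... | inj₁ r≤s with ancestor-or-disjoint x∈ y∈ r≤s
    ...   | inj₁ y-anc-x  = inj₂ (inj₁ y-anc-x)
    ...   | inj₂ disjoint = inj₁ disjoint
    trichotomy {x} {y} x∈ y∈ | inj₂ s≤r with ancestor-or-disjoint y∈ x∈ s≤r
    ...   | inj₁ x-anc-y  = inj₂ (inj₂ x-anc-y)
    ...   | inj₂ disjoint = inj₁ λ (p∈x , p∈y) → disjoint (p∈y , p∈x)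

    laminar : Laminar IsNode area
    laminar x∈ y∈ with trichotomy x∈ y∈
    ... | inj₁ disjoint        = inj₁ disjoint
    ... | inj₂ (inj₁ y-anc-x)  = inj₂ (inj₁ (area-path y-anc-x))
    ... | inj₂ (inj₂ x-anc-y)  = inj₂ (inj₂ (area-path x-anc-y))

    laminarAlongTree : LaminarAlongTree
    laminarAlongTree = area-up , disjoint
      where
      disjoint : ∀ {x y} → x ∈ IsNode → y ∈ IsNode →
                 ¬ x AncestorOf y → ¬ y AncestorOf x → area x ⊥ area y
      disjoint x∈ y∈ ¬x-anc-y ¬y-anc-x with trichotomy x∈ y∈
      ... | inj₁ dis             = dis
      ... | inj₂ (inj₁ y-anc-x)  = contradiction y-anc-x ¬y-anc-x
      ... | inj₂ (inj₂ x-anc-y)  = contradiction x-anc-y ¬x-anc-y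

    areasAreSubsets : AreasAreSubsets
    areasAreSubsets {_ , r} _ y≈z y∈ = ≡.trans (≡.sym (owner-cong r y≈z)) y∈

    areasInBalls : AreasInBalls
    areasInBalls {j , r} _ {y} y∈ = begin
      d (loc j) y                ≤⟨ x≤x+y (IsGeneralMetric.nonNegative isMetric) ⟩
      d (loc j) y + d (loc j) y  ≤⟨ proj₂ (owner-OwnedBy r y∈) ⟩
      ⟦ 3 ⟧ * 5^ r               ≤⟨ ⟦⟧*-monoˡ 3 7 (0≤5^ r) ⟩
      ⟦ 7 ⟧ * 5^ r               ∎

    -- The two centres are within 5 times 5 ^ r of each other, and 5 + 7 = 12 is at most 7 times 5.
    nestedBalls : NestedBalls
    nestedBalls {j , r} (x∈ , _ , ≡.refl) = ≡.refl , λ {y} y∈ → begin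
      d (loc (parent (suc r) j)) y    ≤⟨ triangle-≤ (d-flip (proj₂ (up-near x∈))) y∈ ⟩
      ⟦ 5 ⟧ * 5^ r + ⟦ 7 ⟧ * 5^ r     ≈⟨ solve 1 (λ p → num 5 :* p :+ num 7 :* p := num 12 :* p) refl (5^ r) ⟩
      ⟦ 12 ⟧ * 5^ r                   ≤⟨ ⟦⟧*-monoˡ 12 35 (0≤5^ r) ⟩
      ⟦ 35 ⟧ * 5^ r                   ≈⟨ solve 1 (λ p → num 35 :* p := num 7 :* (num 5 :* p)) refl (5^ r) ⟩
      ⟦ 7 ⟧ * (⟦ 5 ⟧ * 5^ r)          ∎

    -- Cost of nodes and the level chosen for a ball

    nodeCost≤ : ∀ {x} → x ∈ IsNode → nodeCost x ≤ ⟦ 8 ⟧ * 5^ (proj₂ x)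
    nodeCost≤ {j , r} (j∈ , _) = begin
      f j + ⟦ 7 ⟧ * 5^ r       ≤⟨ +-mono-≤ f≤5^r ≤-refl ⟩
      5^ r + ⟦ 7 ⟧ * 5^ r      ≈⟨ solve 1 (λ p → p :+ num 7 :* p := num 8 :* p) refl (5^ r) ⟩
      ⟦ 8 ⟧ * 5^ r             ∎
      where
      f≤5^r : f j ≤ 5^ r
      f≤5^r = begin
        f j          ≈⟨ solve 1 (λ x → x := num 1 :* x) refl (f j) ⟩
        ⟦ 1 ⟧ * f j  ≤⟨ ⟦⟧*-monoˡ 1 4 (proj₁ (f>0 j)) ⟩
        ⟦ 4 ⟧ * f j  ≤⟨ All.lookup (net-eligible r) j∈ ⟩
        5^ r         ∎

    Fits : Fin n × ℝ → ℕ → Set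
    Fits (j , R) r = Eligible r j × R + R ≤ 5^ r

    fits? : ∀ b r → Dec (Fits b r)
    fits? (j , R) r = eligible? r j ×-dec (R + R ≤? 5^ r)

    -- Both conditions hold once 5 ^ r reaches 4 f + 2 R; the search then descends from such a
    -- level.
    fitting-level : ∀ b → 0# ≤ proj₂ b →
                    ∃[ r ] Fits b r × (∀ {k} → r ≡ suc k → ¬ Fits b k)
    fitting-level b@(j , R) 0≤R with 5^-unbounded (⟦ 4 ⟧ * f j + (R + R))
    ... | r , ≤5^r = crossing (fits? b) {r}
      ( ≤-trans (x≤x+y (≤-trans 0≤R (x≤x+y 0≤R))) ≤5^r
      , ≤-trans (x≤y+x (*-nonNegative 0≤⟦ 4 ⟧ (proj₁ (f>0 j)))) ≤5^r)

    -- At level zero 5 ^ r is 1, and the factor `min 1# fmin` is at most the facility cost. Above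
    -- it, one condition fails one level down, so 5 ^ k is at most 4 f or 2 R; returning to level k
    -- + 1 multiplies by 5, whence 20.
    level-cost : ∀ b → 0# ≤ proj₂ b → ∀ r → (∀ {k} → r ≡ suc k → ¬ Fits b k) →
                 min 1# fmin * 5^ r ≤ ⟦ 20 ⟧ * ballCost b
    level-cost (j , R) 0≤R zero _ = begin
      min 1# fmin * 1#     ≈⟨ *-identityʳ _ ⟩
      min 1# fmin          ≤⟨ min≤y 1# fmin ⟩
      fmin                 ≤⟨ proj₂ fmin-min j ⟩
      f j                  ≤⟨ x≤x+y 0≤R ⟩
      f j + R              ≈⟨ solve 1 (λ c → c := num 1 :* c) refl (f j + R) ⟩
      ⟦ 1 ⟧ * (f j + R)    ≤⟨ ⟦⟧*-monoˡ 1 20 (≤-trans (proj₁ (f>0 j)) (x≤x+y 0≤R)) ⟩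
      ⟦ 20 ⟧ * (f j + R)   ∎
    level-cost b@(j , R) 0≤R (suc k) ¬fits = begin
      min 1# fmin * 5^ (suc k)     ≤⟨ *-monoˡ-≤ (0≤5^ (suc k)) (min≤x 1# fmin) ⟩
      1# * 5^ (suc k)              ≈⟨ *-identityˡ _ ⟩
      ⟦ 5 ⟧ * 5^ k                 ≤⟨ *-monoʳ-≤ 0≤⟦ 5 ⟧ 5^k≤ ⟩
      ⟦ 5 ⟧ * (⟦ 4 ⟧ * (f j + R))  ≈⟨ solve 1 (λ c → num 5 :* (num 4 :* c) := num 20 :* c) refl (f j + R) ⟩
      ⟦ 20 ⟧ * (f j + R)           ∎
      where
      5^k≤ : 5^ k ≤ ⟦ 4 ⟧ * (f j + R)
      5^k≤ with eligible? k j
      ... | no ¬elig = begin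
        5^ k                ≤⟨ ≰⇒≥ ¬elig ⟩
        ⟦ 4 ⟧ * f j         ≤⟨ *-monoʳ-≤ 0≤⟦ 4 ⟧ (x≤x+y 0≤R) ⟩
        ⟦ 4 ⟧ * (f j + R)   ∎
      ... | yes elig = begin
        5^ k                ≤⟨ ≰⇒≥ (λ 2R≤ → ¬fits ≡.refl (elig , 2R≤)) ⟩
        R + R               ≈⟨ solve 1 (λ R → R :+ R := num 2 :* R) refl R ⟩
        ⟦ 2 ⟧ * R           ≤⟨ ⟦⟧*-monoˡ 2 4 0≤R ⟩
        ⟦ 4 ⟧ * R           ≤⟨ *-monoʳ-≤ 0≤⟦ 4 ⟧ (x≤y+x (proj₁ (f>0 j))) ⟩
        ⟦ 4 ⟧ * (f j + R)   ∎

    -- The height bound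

    heightAtMost : ∀ {W L} → (∀ {k} → t ≡ suc k → ¬ (W + W ≤ 5^ k × ⟦ 4 ⟧ * fmin ≤ 5^ k)) →
      (max W fmin * fmin ⁻¹) Is2^ L → HeightAtMost 𝓡 T (⟦ 1 ⟧ * L)
    heightAtMost {W} {L} t-minimal (_ , is2^) {x} path = begin
      -- The number h of edges enters the definition of the logarithm as the rational (h - 0) / 1.
      ⟦ edges path ⟧      ≤⟨ Equivalence.from (is2^ (edges path) 0 1) bound ⟩
      0# + ⟦ 1 ⟧ * L      ≈⟨ +-identityˡ _ ⟩
      ⟦ 1 ⟧ * L           ∎
      where
      low : ∀ {x y} (path : Star _⊲_ x y) → y ∈ IsNode → x ∈ IsNode
      low ε            y∈ = y∈
      low (x⊲z ◅ _)    _  = proj₁ x⊲z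

      x∈ : x ∈ IsNode
      x∈ = low path root-node

      4fmin≤ : ⟦ 4 ⟧ * fmin ≤ 5^ (proj₂ x)
      4fmin≤ = ≤-trans (*-monoʳ-≤ 0≤⟦ 4 ⟧ (proj₂ fmin-min (proj₁ x)))
        (All.lookup (net-eligible (proj₂ x)) (proj₁ x∈))

      grow : ∀ h r {u} → 0# ≤ u → ⟦ 4 ⟧ * u ≤ 5^ r → ⟦ 4 ⟧ * (⟦ 2 ⟧ ^ h * u) ≤ 5^ (h ℕ.+ r)
      grow zero    r {u} 0≤u 4u≤ = ≤-trans (≤-reflexive (*-congˡ (*-identityˡ u))) 4u≤
      grow (suc h) r {u} 0≤u 4u≤ = begin
        ⟦ 4 ⟧ * (⟦ 2 ⟧ * ⟦ 2 ⟧ ^ h * u)    ≈⟨ solve 3 (λ q p u → num 4 :* ((q :* p) :* u) := q :* (num 4 :* (p :* u))) refl ⟦ 2 ⟧ (⟦ 2 ⟧ ^ h) u ⟩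
        ⟦ 2 ⟧ * (⟦ 4 ⟧ * (⟦ 2 ⟧ ^ h * u))  ≤⟨ *-monoʳ-≤ 0≤⟦ 2 ⟧ (grow h r 0≤u 4u≤) ⟩
        ⟦ 2 ⟧ * 5^ (h ℕ.+ r)               ≤⟨ ⟦⟧*-monoˡ 2 5 (0≤5^ (h ℕ.+ r)) ⟩
        ⟦ 5 ⟧ * 5^ (h ℕ.+ r)               ∎

      -- A path of length zero is handled by the maximum with `fmin`. Otherwise the growth is run
      -- only up to level `t - 1`, where 5 ^ (t - 1) is at most 2 W; the factor 4 of eligibility
      -- pays for the missing power of two and for the 2 in front of W.
      2^h*fmin≤ : ∀ h → h ℕ.+ proj₂ x ≡ t → ⟦ 2 ⟧ ^ h * fmin ≤ max W fmin
      2^h*fmin≤ zero    _  = ≤-trans (≤-reflexive (*-identityˡ fmin)) (y≤max W fmin)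
      2^h*fmin≤ (suc h) eq = ≤-trans (x+x-cancel-≤ (begin
        2^1+h*fmin + 2^1+h*fmin            ≈⟨ solve 2 (λ p u → (num 2 :* p) :* u :+ (num 2 :* p) :* u := num 4 :* (p :* u)) refl (⟦ 2 ⟧ ^ h) fmin ⟩
        ⟦ 4 ⟧ * (⟦ 2 ⟧ ^ h * fmin)         ≤⟨ grow h (proj₂ x) (proj₁ 0<fmin) 4fmin≤ ⟩
        -- The condition on 4 fmin already holds at level `t - 1`, so it is the one on 2 W that
        -- fails there.
        5^ (h ℕ.+ proj₂ x)                 ≤⟨ ≰⇒≥ (λ 2W≤ → t-minimal (≡.sym eq) (2W≤ ,
                                                ≤-trans 4fmin≤ (5^-mono (ℕ.≤⇒≤′ (ℕ.m≤n+m (proj₂ x) h))))) ⟩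
        W + W                              ∎)) (x≤max W fmin)
        where 2^1+h*fmin = ⟦ 2 ⟧ ^ suc h * fmin

      bound : ⟦ 2 ⟧ ^ edges path ≤ ⟦ 2 ⟧ ^ 0 * (max W fmin * fmin ⁻¹) ^ 1
      bound = begin
        ⟦ 2 ⟧ ^ h                                ≈⟨ *-identityʳ _ ⟨
        ⟦ 2 ⟧ ^ h * 1#                           ≈⟨ *-congˡ (⁻¹-inverseʳ (λ fmin≈0 → proj₂ 0<fmin (sym fmin≈0))) ⟨
        ⟦ 2 ⟧ ^ h * (fmin * fmin ⁻¹)             ≈⟨ *-assoc _ _ _ ⟨
        ⟦ 2 ⟧ ^ h * fmin * fmin ⁻¹               ≤⟨ *-monoˡ-≤ (⁻¹-nonNegative 0<fmin) (2^h*fmin≤ h (edges+level path)) ⟩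
        max W fmin * fmin ⁻¹                     ≈⟨ solve 1 (λ y → y := con 1 :* (y :* con 1)) refl (max W fmin * fmin ⁻¹) ⟩
        1# * (max W fmin * fmin ⁻¹ * 1#)         ∎
        where h = edges path

    -- Since 2 W is at most 5 ^ t, the cheapest facility touches every point at the top level, where
    -- the root is the only possible owner.
    everywhere-owned : ∀ y → y ∈ area root
    everywhere-owned y with touched⇒owned t (cheapest-eligible , diameter≤ (loc cheapest) y)
    ... | k , owned = ≡.subst (λ x → y ∈ area x)
      (top-is-root (proj₁ (owner-OwnedBy t owned) , ℕ.≤-refl) ≡.refl) owned

    -- The degree bound by packing

    module _ {D : ℝ} (doubling : Doubling D) where

      net-packing : ∀ k r x {I : Set} (g : I → Fin n) {is} →
        AllPairs (λ i j → ¬ Near r (g i) (g j)) is →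
        All (λ i → loc (g i) ∈ Ball x (double^ k (half (5^ r)))) is → ⟦ length is ⟧ ≤ D ^ k
      net-packing k r x g separated = packing doubling k (half (5^ r)) x (λ i → loc (g i))
        (AllPairs.map (λ far d≤ → far (≤-trans d≤ (≤-reflexive (half+half (5^ r))))) separated)

      -- Children are net members of one level r within 5 times 5 ^ r of the parent. This is at most
      -- 8 times 5 ^ r, that is 2 ^ 4 times the packing radius 5 ^ r / 2, which gives the exponent
      -- 4.
      degreeAtMost : DegreeAtMost 𝓡 T (D ^ 4)
      degreeAtMost {j , _} _ []  _ _ = ^-nonNegative 4 (0≤D doubling (loc j))
      degreeAtMost {j , s} _ xs@(x ∷ _) distinct children@(child ∷ _) =
        net-packing 4 r (loc j) proj₁
          (AllPairs-mapWithAll separated (All.map at-level children) distinct)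
          (All.map inside children)
        where
        -- The common level of the children is read off the first one; `at-level` transfers it to
        -- the others.
        r = proj₂ x
        s≡suc-r : s ≡ suc r
        s≡suc-r = ≡.cong proj₂ (proj₂ (proj₂ child))
        at-level : ∀ {y} → y ⊲ (j , s) → proj₁ y ∈ˡ net r × proj₂ y ≡ r
        at-level ((y∈ , _) , _ , eq) with ℕ.suc-injective (≡.trans (≡.sym s≡suc-r) (≡.cong proj₂ eq))
        ... | ≡.refl = y∈ , ≡.refl
        separated : ∀ {y z} → proj₁ y ∈ˡ net r × proj₂ y ≡ r → proj₁ z ∈ˡ net r × proj₂ z ≡ r →
                    y ≢ z → ¬ Near r (proj₁ y) (proj₁ z)
        separated (y∈ , ≡.refl) (z∈ , ≡.refl) y≢z near = y≢z (≡.cong (_, r) (net-unique r y∈ z∈ near))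
        inside : ∀ {y} → y ⊲ (j , s) → loc (proj₁ y) ∈ Ball (loc j) (double^ 4 (half (5^ r)))
        inside {k , q} child′@(y∈ , _ , ≡.refl) with at-level child′
        ... | _ , ≡.refl = begin
          d (loc j) (loc k)                    ≤⟨ d-flip (proj₂ (up-near y∈)) ⟩
          ⟦ 5 ⟧ * 5^ r                         ≤⟨ ⟦⟧*-monoˡ 5 8 (0≤5^ r) ⟩
          ⟦ 8 ⟧ * 5^ r                         ≈⟨ *-congˡ (half+half (5^ r)) ⟨
          ⟦ 8 ⟧ * (half (5^ r) + half (5^ r))  ≈⟨ solve 1 (λ h → num 8 :* (h :+ h) := let h₂ = h :+ h; h₄ = h₂ :+ h₂; h₈ = h₄ :+ h₄ in h₈ :+ h₈) refl (half (5^ r)) ⟩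
          double^ 4 (half (5^ r))              ∎

      -- Covering balls by areas within the budget

      CoversBall : Fin n × ℝ → ℕ → List (Fin n × ℕ) → Set _
      CoversBall (j , R) r S = All IsNode S ×
        (∀ {y} → y ∈ Ball (loc j) R → Any (λ x → y ∈ area x) S) ×
        ⟦ length S ⟧ ≤ D ^ 2 × All (λ x → nodeCost x ≤ ⟦ 8 ⟧ * 5^ r) S

      -- When the level chosen for the ball is at or above the top, the root alone covers the whole
      -- space and is no dearer than a node of level `r` would be.
      cover-by-root : ∀ b {r} → t ℕ.≤ r → CoversBall b r (root ∷ [])
      cover-by-root (j , R) {r} t≤r = root-node ∷ [] , (λ {y} _ → here (everywhere-owned y)) , 1≤D² ,
        ≤-trans (nodeCost≤ root-node) (*-monoʳ-≤ 0≤⟦ 8 ⟧ (5^-mono (ℕ.≤⇒≤′ t≤r))) ∷ []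
        where
        1≤D² : ⟦ 1 ⟧ ≤ D ^ 2
        1≤D² = begin
          ⟦ 1 ⟧     ≈⟨ +-identityʳ 1# ⟩
          1#        ≤⟨ 1≤D doubling (loc j) ⟩
          D         ≈⟨ *-identityʳ D ⟨
          D * 1#    ≤⟨ *-monoʳ-≤ (0≤D doubling (loc j)) (≤-trans (1≤D doubling (loc j)) (≤-reflexive (sym (*-identityʳ D)))) ⟩
          D ^ 2     ∎

      -- The centre `j` touches every point of its ball, so each point has an owner, and all owners
      -- lie within 2 times 5 ^ r of `j`. That is 2 ^ 2 times the packing radius, which gives the
      -- exponent 2.
      cover-at-level : ∀ b {r} → r ℕ.≤ t → Fits b r → ∃[ S ] CoversBall b r S
      cover-at-level (j , R) {r} r≤t (elig , 2R≤) = S ,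
        S-nodes , covers ,
        ≤-trans (≤-reflexive (reflexive (≡.cong ⟦_⟧ (length-map (_, r) ks))))
          (net-packing 2 r (loc j) (λ k → k) (AllPairs.filter⁺ close? (net-separated r))
            (All.map (λ close → ≤-trans close 2·5^r≤) (All.all-filter close? (net r)))) ,
        All.map⁺ (All.map (λ k∈ → nodeCost≤ (k∈ , r≤t)) ks⊆net)
        where
        close? : ∀ k → Dec (d (loc j) (loc k) ≤ ⟦ 2 ⟧ * 5^ r)
        close? k = d (loc j) (loc k) ≤? ⟦ 2 ⟧ * 5^ r
        ks : List (Fin n)
        ks = filter close? (net r)
        S : List (Fin n × ℕ)
        S = map (_, r) ks
        ks⊆net : All (_∈ˡ net r) ks
        ks⊆net = All.filter⁺ close? (All.tabulate (λ k∈ → k∈))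
        S-nodes : All IsNode S
        S-nodes = All.map⁺ (All.map (_, r≤t) ks⊆net)
        2·5^r≤ : ⟦ 2 ⟧ * 5^ r ≤ double^ 2 (half (5^ r))
        2·5^r≤ = ≤-reflexive (trans (*-congˡ (sym (half+half (5^ r))))
          (solve 1 (λ h → num 2 :* (h :+ h) := let h₂ = h :+ h in h₂ :+ h₂) refl (half (5^ r))))
        covers : ∀ {y} → y ∈ Ball (loc j) R → Any (λ x → y ∈ area x) S
        covers {y} y∈ with touched⇒owned r (elig , ≤-trans (+-mono-≤ y∈ y∈) 2R≤)
        ... | k , owned with owner-OwnedBy r owned
        ...   | k∈ , 2dky≤ = lose∈ (∈-map⁺ (_, r) (∈-filter⁺ close? k∈ (x+x-cancel-≤ 2djk≤))) owned
          where
          2djk≤ : d (loc j) (loc k) + d (loc j) (loc k) ≤ ⟦ 2 ⟧ * 5^ r + ⟦ 2 ⟧ * 5^ r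
          2djk≤ = begin
            d (loc j) (loc k) + d (loc j) (loc k)     ≤⟨ +-mono-≤ tri tri ⟩
            (R + d (loc k) y) + (R + d (loc k) y)     ≈⟨ solve 2 (λ R δ → (R :+ δ) :+ (R :+ δ) := (R :+ R) :+ (δ :+ δ)) refl R (d (loc k) y) ⟩
            (R + R) + (d (loc k) y + d (loc k) y)     ≤⟨ +-mono-≤ 2R≤ 2dky≤ ⟩
            5^ r + ⟦ 3 ⟧ * 5^ r                       ≈⟨ solve 1 (λ p → p :+ num 3 :* p := num 2 :* p :+ num 2 :* p) refl (5^ r) ⟩
            ⟦ 2 ⟧ * 5^ r + ⟦ 2 ⟧ * 5^ r               ∎
            where
            tri : d (loc j) (loc k) ≤ R + d (loc k) y
            tri = triangle-≤ y∈ (≤-reflexive (d-sym y (loc k)))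

      Affordable : ℝ → Pred Point 0ℓ → Set v
      Affordable budget P = ∃[ S ] All IsNode S ×
        (∀ {y} → y ∈ P → Any (λ x → y ∈ area x) S) ×
        min 1# fmin * sumOver nodeCost S ≤ budget

      0≤min : 0# ≤ min 1# fmin
      0≤min = min-glb 0≤1 (proj₁ 0<fmin)

      -- There are at most `D ^ 2` nodes, each of cost at most 8 times 5 ^ r, and `level-cost`
      -- contributes 20, so the constant is 8 times 20.
      cover-cost : ∀ b → 0# ≤ proj₂ b → ∀ {r S} → (∀ {k} → r ≡ suc k → ¬ Fits b k) →
                   CoversBall b r S → min 1# fmin * sumOver nodeCost S ≤ (⟦ 160 ⟧ * D ^ 2) * ballCost b
      cover-cost b 0≤R {r} {S} ¬fits (_ , _ , few , cheap) = begin
        μ * sumOver nodeCost S              ≤⟨ *-monoʳ-≤ 0≤min (sumOver≤length* cheap) ⟩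
        μ * (⟦ length S ⟧ * (⟦ 8 ⟧ * 5^ r)) ≈⟨ solve 4 (λ μ l e p → μ :* (l :* (e :* p)) := (l :* e) :* (μ :* p)) refl μ ⟦ length S ⟧ ⟦ 8 ⟧ (5^ r) ⟩
        (⟦ length S ⟧ * ⟦ 8 ⟧) * (μ * 5^ r) ≤⟨ *-monoˡ-≤ (*-nonNegative 0≤min (0≤5^ r)) (*-monoˡ-≤ 0≤⟦ 8 ⟧ few) ⟩
        (D ^ 2 * ⟦ 8 ⟧) * (μ * 5^ r)        ≤⟨ *-monoʳ-≤ (*-nonNegative (^-nonNegative 2 (0≤D doubling (loc (proj₁ b)))) 0≤⟦ 8 ⟧) (level-cost b 0≤R r ¬fits) ⟩
        (D ^ 2 * ⟦ 8 ⟧) * (⟦ 20 ⟧ * ballCost b) ≈⟨ solve 4 (λ u e w c → (u :* e) :* (w :* c) := ((e :* w) :* u) :* c) refl (D ^ 2) ⟦ 8 ⟧ ⟦ 20 ⟧ (ballCost b) ⟩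
        ((⟦ 8 ⟧ * ⟦ 20 ⟧) * D ^ 2) * ballCost b ≈⟨ *-congʳ (*-congʳ (⟦⟧-* 8 20)) ⟨
        (⟦ 160 ⟧ * D ^ 2) * ballCost b                      ∎
        where μ = min 1# fmin

      cover-ball : ∀ b → 0# ≤ proj₂ b →
        Affordable (⟦ 160 ⟧ * D ^ 2 * ballCost b) (Ball (loc (proj₁ b)) (proj₂ b))
      cover-ball b 0≤R with fitting-level b 0≤R
      ... | r , fits , ¬fits =
        proj₁ covering , nodes , covers , cover-cost b 0≤R ¬fits (proj₂ covering)
        where
        covering : ∃[ S ] CoversBall b r S
        covering with ℕ.≤-total r t
        ... | inj₁ r≤t = cover-at-level b r≤t fits
        ... | inj₂ t≤r = root ∷ [] , cover-by-root b t≤r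
        nodes = proj₁ (proj₂ covering)
        covers = proj₁ (proj₂ (proj₂ covering))

      cover-balls : ∀ δ →
        (∀ b → 0# ≤ proj₂ b → Affordable (δ * ballCost b) (Ball (loc (proj₁ b)) (proj₂ b))) →
        ∀ 𝓑 → All (λ (_ , R) → 0# ≤ R) 𝓑 →
        Affordable (δ * sumOver ballCost 𝓑) (λ y → Any (λ (j , R) → y ∈ Ball (loc j) R) 𝓑)
      cover-balls δ cover₁ [] [] = [] , [] , (λ ()) , ≤-reflexive (trans (zeroʳ _) (sym (zeroʳ δ)))
      cover-balls δ cover₁ (b ∷ 𝓑) (0≤R ∷ 0≤Rs) with cover₁ b 0≤R | cover-balls δ cover₁ 𝓑 0≤Rs
      ... | S₁ , nodes₁ , covers₁ , cost₁ | S₂ , nodes₂ , covers₂ , cost₂ =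
        S₁ ++ S₂ , All.++⁺ nodes₁ nodes₂ ,
        (λ { (here y∈) → Any.++⁺ˡ (covers₁ y∈) ; (there y∈) → Any.++⁺ʳ S₁ (covers₂ y∈) }) ,
        (begin
          μ * sumOver nodeCost (S₁ ++ S₂)                     ≈⟨ *-congˡ (sumOver-++ nodeCost S₁ S₂) ⟩
          μ * (sumOver nodeCost S₁ + sumOver nodeCost S₂)     ≈⟨ distribˡ μ _ _ ⟩
          μ * sumOver nodeCost S₁ + μ * sumOver nodeCost S₂   ≤⟨ +-mono-≤ cost₁ cost₂ ⟩
          δ * ballCost b + δ * sumOver ballCost 𝓑             ≈⟨ distribˡ δ _ _ ⟨
          δ * sumOver ballCost (b ∷ 𝓑)                        ∎)
        where μ = min 1# fmin

      coversByNodes : ∀ {c} → CoversByNodes c fmin (⟦ 160 ⟧ * D ^ 2)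
      coversByNodes C 𝓑 0≤Rs C⊆𝓑 =
        let S , nodes , covers , cost = cover-balls (⟦ 160 ⟧ * D ^ 2) cover-ball 𝓑 0≤Rs
        in S , nodes , (λ y∈C → covers (C⊆𝓑 y∈C)) , cost

-- Choice of the top level and of the constants

theorem2 : ∀ {v ℓ c : Level} →
  Σ[ c₁ ∈ ℕ ] Σ[ c₂ ∈ ℕ ]
  ((𝓡 : RealField) (M : MetricSpace 𝓡 v ℓ) →
   let open RealField 𝓡
       open MetricSpace M in
   (κ 2^κ W : ℝ) → 2^κ Is2^ κ → Doubling 2^κ → IsDiameter W →
   (n : ℕ) (loc : Fin n → Point) → Injective _≡_ _≈ᵥ_ loc →
   (f : Fin n → ℝ) → (∀ j → 0# < f j) →
   (fmin : ℝ) → IsMinimum f fmin →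
   Σ[ T ∈ RootedTree (Fin n × ℕ) ]
   Σ[ A ∈ (Fin n × ℕ → Pred Point 0ℓ) ]
   let open RootedTree T
       open Hierarchy M loc f T A in
     ((∀ L → (max W fmin * fmin ⁻¹) Is2^ L → HeightAtMost 𝓡 T (⟦ c₁ ⟧ * L)) ×
      DegreeAtMost 𝓡 T (2^κ ^ 4) ×
      NestedBalls) ×
     (AreasAreSubsets ×
      Laminar Node A ×
      LaminarAlongTree ×
      AreasInBalls) ×
     CoversByNodes c fmin (⟦ c₂ ⟧ * 2^κ ^ 2))
theorem2 = 1 , 160 , λ 𝓡 M κ 2^κ W _ doubling (d≤W , _) n loc _ f f>0 fmin fmin-min →
  let open RealField 𝓡
      open RealProperties 𝓡
      u , ≤5^u = 5^-unbounded (max (W + W) (⟦ 4 ⟧ * fmin))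
      -- The condition on 2 W leaves a single node at the top and the one on 4 fmin makes the
      -- cheapest facility eligible there; failure one level down bounds the height.
      t , (2W≤5^t , 4fmin≤5^t) , t-minimal =
        crossing (λ r → (W + W ≤? 5^ r) ×-dec (⟦ 4 ⟧ * fmin ≤? 5^ r)) {u}
          (≤-trans (x≤max _ _) ≤5^u , ≤-trans (y≤max _ _) ≤5^u)
      module 𝒯 = Nets.Tree M loc f f>0 fmin-min t 4fmin≤5^t
        (λ x y → ≤-trans (+-mono-≤ (d≤W x y) (d≤W x y)) 2W≤5^t)
  in 𝒯.T , 𝒯.area ,
     ( (λ L → 𝒯.heightAtMost t-minimal)
     , 𝒯.degreeAtMost doubling
     , λ {x} {y} → 𝒯.nestedBalls {x} {y}) ,
     (𝒯.areasAreSubsets , 𝒯.laminar , 𝒯.laminarAlongTree , 𝒯.areasInBalls) ,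
     𝒯.coversByNodes doubling
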